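{- For all $d\in\mathbb{N}$ and $\mathbf{s}\in(\mathbb{Z}\setminus\{0\})^d$, $$M_{\mathcal A}(\overleftarrow{\mathbf{s}})=(-1)^{|\mathbf{s}|}M_{\mathcal A}(-\mathbf{s}).$$ In particular, for all $\mathbf{s}\in\mathbb{N}^d$, $$t_{\mathcal A}(\overleftarrow{\mathbf{s}})=(-1)^{|\mathbf{s}|}\zeta^{(2)}_{\mathcal A}(\mathbf{s});$$ if $d$ is even, then $$T_{\mathcal A}(\overleftarrow{\mathbf{s}})=(-1)^{|\mathbf{s}|}T_{\mathcal A}(\mathbf{s})\quad\text{and}\quad S_{\mathcal A}(\overleftarrow{\mathbf{s}})=(-1)^{|\mathbf{s}|}S_{\mathcal A}(\mathbf{s});$$ and if $d$ is odd, then $$T_{\mathcal A}(\overleftarrow{\mathbf{s}})=(-1)^{|\mathbf{s}|}S_{\mathcal A}(\mathbf{s})\quad\text{and}\quad S_{\mathcal A}(\overleftarrow{\mathbf{s}})=(-1)^{|\mathbf{s}|}T_{\mathcal A}(\mathbf{s}).$$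
   Context: Let $\mathcal{P}$ be the set of primes and $\mathcal{A}=\prod_{p\in\mathcal P}(\mathbb{Z}/p\mathbb{Z})\big/\bigoplus_{p\in\mathcal P}(\mathbb{Z}/p\mathbb{Z})$; two families of residues are equal in $\mathcal A$ iff they agree for all but finitely many $p$. $\mathbb{N}$ is the set of positive integers. For $\mathbf{s}=(s_1,\dots,s_d)\in(\mathbb{Z}\setminus\{0\})^d$ put $|\mathbf{s}|=|s_1|+\cdots+|s_d|$, $-\mathbf{s}=(-s_1,\dots,-s_d)$, $\overleftarrow{\mathbf{s}}=(s_d,\dots,s_1)$. The finite multiple mixed value is $$M_{\mathcal A}(\mathbf{s})=\Bigg(\sum_{\substack{p>n_1>\cdots>n_d>0\\ n_j\text{ even if }s_j>0,\ n_j\text{ odd if }s_j<0}}\ \prod_{j=1}^d\frac1{n_j^{|s_j|}}\bmod p\Bigg)_{p\in\mathcal P}\in\mathcal A.$$ For $\mathbf{s}\in\mathbb{N}^d$: $t_{\mathcal A}(\mathbf{s})=M_{\mathcal A}(-s_1,\dots,-s_d)$ (all $n_j$ odd); $\zeta^{(2)}_{\mathcal A}(\mathbf{s})=M_{\mathcal A}(s_1,\dots,s_d)$ (all $n_j$ even); $T_{\mathcal A}(\mathbf{s})=M_{\mathcal A}\big((-1)^{d}s_1,\dots,(-1)^{d-j+1}s_j,\dots,-s_d\big)$ (i.e. $n_j\equiv d-j+1 \pmod 2$); $S_{\mathcal A}(\mathbf{s})=M_{\mathcal A}\big((-1)^{d-1}s_1,\dots,(-1)^{d-j}s_j,\dots,s_d\big)$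 (i.e. $n_j\equiv d-j\pmod 2$). -}

module Defs where

open import Algebra.Bundles using (CommutativeRing)
open import Data.Fin.Base using (toℕ)
open import Data.Integer.Base as ℤ using (ℤ; +_; 0ℤ; 1ℤ; -1ℤ; ∣_∣)
import Data.Integer.Properties as ℤ
open import Data.Integer.Divisibility.Signed as ℤ∣ using (divides)
open import Data.Integer.Tactic.RingSolver using (solve-∀)
open import Data.List.Base as List using (List; []; _∷_; [_]; _++_)
open import Data.List.Membership.Propositional using (_∉_)
open import Data.List.Membership.Propositional.Properties using (∈-++⁺ˡ; ∈-++⁺ʳ)
open import Data.Nat.Base as ℕ using (ℕ; zero; suc; _>_; _∸_)
import Data.Nat.Properties as ℕ
open import Data.Nat.Coprimality as Coprimality using (prime⇒coprime; coprime⇒GCD≡1)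
open import Data.Nat.Divisibility using (_∣_; _∣?_)
open import Data.Nat.GCD using (module GCD; module Bézout)
open import Data.Nat.Primality using (Prime)
open import Data.Product.Base using (∃; _×_; _,_)
open import Data.Vec.Base as Vec using (Vec; []; _∷_; _∷ʳ_; lookup; tabulate; zipWith)
open import Data.Vec.Relation.Binary.Pointwise.Inductive as Pointwise using (Pointwise)
open import Data.Vec.Relation.Unary.Linked using (Linked; linked?)
open import Function.Base using (_∘_)
open import Level using (0ℓ)
open import Relation.Binary.PropositionalEquality
  using (_≡_; refl; sym; cong; subst; module ≡-Reasoning)
open import Relation.Nullary using (Dec; ¬_)
open import Relation.Nullary.Decidable using (_×-dec_; _→-dec_; ¬?)

-- ℤ/nℤ is represented by ℤ with this congruence as its equality.
_≡_[mod_] : ℤ → ℤ → ℕ → Set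
a ≡ b [mod n ] = (+ n) ℤ∣.∣ (a ℤ.- b)

Family : Set
Family = (p : ℕ) → .(Prime p) → ℤ

-- Equality modulo ⨁ ℤ/pℤ: agreement outside a finite list of exceptions.
_≈𝒜_ : Family → Family → Set
f ≈𝒜 g = ∃ λ (exceptions : List ℕ) →
  ∀ p .(pr : Prime p) → p ∉ exceptions → f p pr ≡ g p pr [mod p ]

private
  along : ∀ n {a b} → a ≡ b → (+ n) ℤ∣.∣ a → (+ n) ℤ∣.∣ b
  along n = subst ((+ n) ℤ∣.∣_)

  mod-reflexive : ∀ n {a b} → a ≡ b → a ≡ b [mod n ]
  mod-reflexive n {a} refl = divides 0ℤ (ℤ.+-inverseʳ a)

  mod-sym : ∀ n a b → a ≡ b [mod n ] → b ≡ a [mod n ]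
  mod-sym n a b h = along n (eq a b) (ℤ∣.∣m⇒∣-m h)
    where
    eq : ∀ a b → ℤ.- (a ℤ.- b) ≡ b ℤ.- a
    eq = solve-∀

  mod-trans : ∀ n a b c → a ≡ b [mod n ] → b ≡ c [mod n ] → a ≡ c [mod n ]
  mod-trans n a b c h k = along n (eq a b c) (ℤ∣.∣m∣n⇒∣m+n h k)
    where
    eq : ∀ a b c → (a ℤ.- b) ℤ.+ (b ℤ.- c) ≡ a ℤ.- c
    eq = solve-∀

  mod-+ : ∀ n a b c d → a ≡ b [mod n ] → c ≡ d [mod n ] → (a ℤ.+ c) ≡ (b ℤ.+ d) [mod n ]
  mod-+ n a b c d h k = along n (eq a b c d) (ℤ∣.∣m∣n⇒∣m+n h k)
    where
    eq : ∀ a b c d → (a ℤ.- b) ℤ.+ (c ℤ.- d) ≡ (a ℤ.+ c) ℤ.- (b ℤ.+ d)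
    eq = solve-∀

  mod-* : ∀ n a b c d → a ≡ b [mod n ] → c ≡ d [mod n ] → (a ℤ.* c) ≡ (b ℤ.* d) [mod n ]
  mod-* n a b c d h k =
    along n (eq a b c d) (ℤ∣.∣m∣n⇒∣m+n (ℤ∣.∣n⇒∣m*n c h) (ℤ∣.∣n⇒∣m*n b k))
    where
    eq : ∀ a b c d → c ℤ.* (a ℤ.- b) ℤ.+ b ℤ.* (c ℤ.- d) ≡ (a ℤ.* c) ℤ.- (b ℤ.* d)
    eq = solve-∀

  mod-neg : ∀ n a b → a ≡ b [mod n ] → (ℤ.- a) ≡ (ℤ.- b) [mod n ]
  mod-neg n a b h = along n (eq a b) (ℤ∣.∣m⇒∣-m h)
    where
    eq : ∀ a b → ℤ.- (a ℤ.- b) ≡ (ℤ.- a) ℤ.- (ℤ.- b)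
    eq = solve-∀

  everywhere : ∀ {f g : Family} → (∀ p .(pr : Prime p) → f p pr ≡ g p pr) → f ≈𝒜 g
  everywhere h = [] , λ p pr _ → mod-reflexive p (h p pr)

𝒜 : CommutativeRing 0ℓ 0ℓ
𝒜 = record
  { Carrier = Family
  ; _≈_ = _≈𝒜_
  ; _+_ = λ f g p pr → f p pr ℤ.+ g p pr
  ; _*_ = λ f g p pr → f p pr ℤ.* g p pr
  ; -_  = λ f p pr → ℤ.- f p pr
  ; 0#  = λ _ _ → 0ℤ
  ; 1#  = λ _ _ → 1ℤ
  ; isCommutativeRing = record
    { isRing = record
      { +-isAbelianGroup = record
        { isGroup = record
          { isMonoid = record
            { isSemigroup = record
              { isMagma = record
                { isEquivalence = record
                  { refl  = λ {f} → everywhere {f} {f} (λ _ _ → refl)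
                  ; sym   = λ {f} {g} (E , h) → E , λ p pr p∉E →
                      mod-sym p (f p pr) (g p pr) (h p pr p∉E)
                  ; trans = λ {f} {g} {k} (E , h) (E′ , h′) → E ++ E′ , λ p pr p∉ →
                      mod-trans p (f p pr) (g p pr) (k p pr)
                        (h p pr (p∉ ∘ ∈-++⁺ˡ)) (h′ p pr (p∉ ∘ ∈-++⁺ʳ E))
                  }
                ; ∙-cong = λ {f} {f′} {g} {g′} (E , h) (E′ , h′) → E ++ E′ , λ p pr p∉ →
                    mod-+ p (f p pr) (f′ p pr) (g p pr) (g′ p pr)
                      (h p pr (p∉ ∘ ∈-++⁺ˡ)) (h′ p pr (p∉ ∘ ∈-++⁺ʳ E))
                }
              ; assoc = λ f g h → everywhere λ p pr → ℤ.+-assoc (f p pr) (g p pr) (h p pr)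
              }
            ; identity = (λ f → everywhere λ p pr → ℤ.+-identityˡ (f p pr))
                       , (λ f → everywhere λ p pr → ℤ.+-identityʳ (f p pr))
            }
          ; inverse = (λ f → everywhere λ p pr → ℤ.+-inverseˡ (f p pr))
                    , (λ f → everywhere λ p pr → ℤ.+-inverseʳ (f p pr))
          ; ⁻¹-cong = λ {f} {g} (E , h) → E , λ p pr p∉E →
              mod-neg p (f p pr) (g p pr) (h p pr p∉E)
          }
        ; comm = λ f g → everywhere λ p pr → ℤ.+-comm (f p pr) (g p pr)
        }
      ; *-cong = λ {f} {f′} {g} {g′} (E , h) (E′ , h′) → E ++ E′ , λ p pr p∉ →
          mod-* p (f p pr) (f′ p pr) (g p pr) (g′ p pr)
            (h p pr (p∉ ∘ ∈-++⁺ˡ)) (h′ p pr (p∉ ∘ ∈-++⁺ʳ E))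
      ; *-assoc = λ f g h → everywhere λ p pr → ℤ.*-assoc (f p pr) (g p pr) (h p pr)
      ; *-identity = (λ f → everywhere λ p pr → ℤ.*-identityˡ (f p pr))
                   , (λ f → everywhere λ p pr → ℤ.*-identityʳ (f p pr))
      ; distrib = (λ f g h → everywhere λ p pr → ℤ.*-distribˡ-+ (f p pr) (g p pr) (h p pr))
                , (λ f g h → everywhere λ p pr → ℤ.*-distribʳ-+ (f p pr) (g p pr) (h p pr))
      }
    ; *-comm = λ f g → everywhere λ p pr → ℤ.*-comm (f p pr) (g p pr)
    }
  }

-- The coefficient x in a Bézout identity x n + y p = gcd(n, p). It is a
-- total function, but represents 1/n in ℤ/pℤ only when n is coprime to p;
-- see inverse-correct.
inverse : (p n : ℕ) → ℤ
inverse p n with Bézout.lemma n p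
... | Bézout.result _ _ (Bézout.+- x _ _) = + x
... | Bézout.result _ _ (Bézout.-+ x _ _) = ℤ.- (+ x)

inverse-correct : ∀ {p n} → Prime p → .{{_ : ℕ.NonZero n}} → n ℕ.< p →
                  ((+ n) ℤ.* inverse p n) ≡ 1ℤ [mod p ]
inverse-correct {p} {n} pr n<p with Bézout.lemma n p
... | Bézout.result d g b
  with refl ← GCD.unique g (coprime⇒GCD≡1 (Coprimality.sym (prime⇒coprime pr n<p))) with b
... | Bézout.+- x y eq = divides (+ y) (begin
  + n ℤ.* + x ℤ.- 1ℤ           ≡⟨ cong (ℤ._- 1ℤ) (ℤ.*-comm (+ n) (+ x)) ⟩
  + x ℤ.* + n ℤ.- 1ℤ           ≡⟨ cong (ℤ._- 1ℤ) (sym (ℤ.pos-* x n)) ⟩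
  + (x ℕ.* n) ℤ.- 1ℤ           ≡⟨ cong (λ z → + z ℤ.- 1ℤ) (sym eq) ⟩
  1ℤ ℤ.+ + (y ℕ.* p) ℤ.- 1ℤ    ≡⟨ lem (+ (y ℕ.* p)) ⟩
  + (y ℕ.* p)                  ≡⟨ ℤ.pos-* y p ⟩
  + y ℤ.* + p                  ∎)
  where
  open ≡-Reasoning
  lem : ∀ a → 1ℤ ℤ.+ a ℤ.- 1ℤ ≡ a
  lem = solve-∀
... | Bézout.-+ x y eq = divides (ℤ.- (+ y)) (begin
  + n ℤ.* ℤ.- (+ x) ℤ.- 1ℤ     ≡⟨ lem (+ n) (+ x) ⟩
  ℤ.- (1ℤ ℤ.+ + x ℤ.* + n)     ≡⟨ cong (λ z → ℤ.- (1ℤ ℤ.+ z)) (sym (ℤ.pos-* x n)) ⟩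
  ℤ.- (+ (1 ℕ.+ x ℕ.* n))      ≡⟨ cong (λ z → ℤ.- (+ z)) eq ⟩
  ℤ.- (+ (y ℕ.* p))            ≡⟨ cong ℤ.-_ (ℤ.pos-* y p) ⟩
  ℤ.- (+ y ℤ.* + p)            ≡⟨ ℤ.neg-distribˡ-* (+ y) (+ p) ⟩
  ℤ.- (+ y) ℤ.* + p            ∎)
  where
  open ≡-Reasoning
  lem : ∀ a b → a ℤ.* (ℤ.- b) ℤ.- 1ℤ ≡ ℤ.- (1ℤ ℤ.+ b ℤ.* a)
  lem = solve-∀

Even Odd : ℕ → Set
Even n = 2 ∣ n
Odd  n = ¬ Even n

ParityMatches : ℤ → ℕ → Set
ParityMatches s n = (s ℤ.> 0ℤ → Even n) × (s ℤ.< 0ℤ → Odd n)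

Admissible : ∀ {d} → ℕ → Vec ℤ d → Vec ℕ d → Set
Admissible p s ns = Linked _>_ (p ∷ (ns ∷ʳ 0)) × Pointwise ParityMatches s ns

admissible? : ∀ {d} p (s : Vec ℤ d) (ns : Vec ℕ d) → Dec (Admissible p s ns)
admissible? p s ns =
  linked? ℕ._>?_ (p ∷ (ns ∷ʳ 0)) ×-dec Pointwise.decidable parityMatches? s ns
  where
  parityMatches? : ∀ s n → Dec (ParityMatches s n)
  parityMatches? s n =
    ((0ℤ ℤ.<? s) →-dec (2 ∣? n)) ×-dec ((s ℤ.<? 0ℤ) →-dec ¬? (2 ∣? n))

tuples : ∀ {A : Set} → List A → (d : ℕ) → List (Vec A d)
tuples xs zero    = [ [] ]
tuples xs (suc d) = List.cartesianProductWith _∷_ xs (tuples xs d)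

admissibleTuples : ∀ {d} → ℕ → Vec ℤ d → List (Vec ℕ d)
admissibleTuples {d} p s = List.filter (admissible? p s) (tuples (List.upTo p) d)

sumℤ : List ℤ → ℤ
sumℤ = List.foldr ℤ._+_ 0ℤ

productℤ : ∀ {d} → Vec ℤ d → ℤ
productℤ = Vec.foldr _ ℤ._*_ 1ℤ

M𝒜 : ∀ {d} → Vec ℤ d → Family
M𝒜 s p _ = sumℤ (List.map term (admissibleTuples p s))
  where
  term : Vec ℕ _ → ℤ
  term ns = productℤ (zipWith (λ sⱼ nⱼ → inverse p nⱼ ℤ.^ ∣ sⱼ ∣) s ns)

weight : ∀ {d} → Vec ℤ d → ℕ
weight s = Vec.sum (Vec.map ∣_∣ s)

t𝒜 ζ⁽²⁾𝒜 T𝒜 S𝒜 : ∀ {d} → Vec ℕ d → Family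
t𝒜    s = M𝒜 (Vec.map (λ sⱼ → ℤ.- (+ sⱼ)) s)
ζ⁽²⁾𝒜 s = M𝒜 (Vec.map +_ s)

-- Positions i start at 0, so j = i + 1: the exponents d - j + 1 and d - j
-- become d ∸ i and d ∸ suc i.
T𝒜 {d} s = M𝒜 (tabulate λ i → (-1ℤ ℤ.^ (d ∸ toℕ i)) ℤ.* (+ lookup s i))
S𝒜 {d} s = M𝒜 (tabulate λ i → (-1ℤ ℤ.^ (d ∸ suc (toℕ i))) ℤ.* (+ lookup s i))

open CommutativeRing 𝒜 public using (_≈_; _*_; -_; 1#)
open import Algebra.Properties.Semiring.Exp (CommutativeRing.semiring 𝒜) public using (_^_)

{-# OPTIONS --safe #-}
-- For a prime p ≠ 2 the substitution n_j ↦ p − n_{d+1−j} maps decreasing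
-- tuples in (0, p) to decreasing tuples and, p being odd, flips every parity;
-- since 1/(p − n) ≡ − 1/n (mod p), each term is multiplied by (−1)^|s|.
-- The identities for t, ζ⁽²⁾, T and S are instances: reversal turns the sign
-- exponent at position i into one whose sum with the exponent required at i
-- on the other side is odd.
module Submission where

open import Defs
open import Data.Fin.Base using (Fin; zero; suc; toℕ; fromℕ; inject₁; opposite)
open import Data.Fin.Properties using (toℕ<n; opposite-prop; opposite-involutive)
open import Data.Nat.Base as ℕ using (ℕ; zero; suc; _∸_; _≤_; _<_; _>_)
import Data.Nat.Properties as ℕ
open import Data.Nat.Divisibility as ∣ using (_∣?_; ∣-refl; ∣1⇒≡1)
open import Data.Nat.Primality using (Prime; prime?; prime⇒irreducible)
open import Data.Integer.Base as ℤ using (ℤ; +_; 0ℤ; 1ℤ; -1ℤ; ∣_∣)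
import Data.Integer.Properties as ℤ
open import Data.Integer.Divisibility.Signed as ℤ∣ using (divides)
open import Data.Integer.Tactic.RingSolver using (solve-∀)
open import Data.List.Base as List using (List; []; _∷_; [_])
import Data.List.Properties as List
open import Data.List.Membership.Propositional using (_∈_)
open import Data.List.Membership.Propositional.Properties
  using (∈-cartesianProductWith⁺; ∈-filter⁺; ∈-filter⁻; ∈-map⁺; ∈-map⁻; ∈-upTo⁺)
open import Data.List.Membership.Propositional.Properties.WithK using (unique∧set⇒bag)
open import Data.List.Relation.Binary.BagAndSetEquality using (∼bag⇒↭)
open import Data.List.Relation.Binary.Permutation.Propositional using (_↭_; ↭⇒↭ₛ)
import Data.List.Relation.Binary.Permutation.Propositional.Properties as ↭
import Data.List.Relation.Binary.Permutation.Setoid.Properties as ↭ₛ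
import Data.List.Relation.Unary.All as ListAll
open import Data.List.Relation.Unary.All.Properties using (all-filter)
open import Data.List.Relation.Unary.Any using (here)
open import Data.List.Relation.Unary.Unique.Propositional using (Unique; []; _∷_)
import Data.List.Relation.Unary.Unique.Propositional.Properties as Unique
open import Data.Product.Base using (_×_; _,_; proj₁; proj₂)
open import Data.Sum.Base using (inj₂)
open import Data.Vec.Base using (Vec; []; _∷_; _∷ʳ_; head; lookup; reverse; map; sum; tabulate; zipWith)
open import Data.Vec.Properties
  using (∷-injective; map-∷ʳ; map-∘; map-cong; map-id; map-reverse; reverse-∷;
         reverse-involutive; tabulate-cong; tabulate-∘; tabulate∘lookup; lookup∘tabulate)
open import Data.Vec.Relation.Binary.Pointwise.Inductive using (Pointwise; []; _∷_)
open import Data.Vec.Relation.Unary.All using (All; []; _∷_)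
open import Data.Vec.Relation.Unary.Linked using (Linked; []; [-]; _∷_)
open import Function.Base using (_∘_; flip)
open import Function.Bundles using (mk⇔)
open import Relation.Binary.PropositionalEquality
  using (_≡_; refl; sym; trans; cong; cong₂; subst; subst₂; setoid; module ≡-Reasoning)
open import Relation.Nullary.Decidable using (decidable-stable)
open import Relation.Nullary.Decidable.Core using (recompute)
open import Relation.Nullary.Negation using (¬_; contradiction)

private
  variable
    A B : Set
    d n : ℕ

-- Vectors

reverse-∷ʳ : ∀ (xs : Vec A n) x → reverse (xs ∷ʳ x) ≡ x ∷ reverse xs
reverse-∷ʳ []       x = refl
reverse-∷ʳ (y ∷ xs) x = begin
  reverse (y ∷ (xs ∷ʳ x))   ≡⟨ reverse-∷ y (xs ∷ʳ x) ⟩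
  reverse (xs ∷ʳ x) ∷ʳ y    ≡⟨ cong (_∷ʳ y) (reverse-∷ʳ xs x) ⟩
  x ∷ (reverse xs ∷ʳ y)     ≡⟨ cong (x ∷_) (reverse-∷ y xs) ⟨
  x ∷ reverse (y ∷ xs)      ∎
  where open ≡-Reasoning

lookup-∷ʳ-fromℕ : ∀ (xs : Vec A n) x → lookup (xs ∷ʳ x) (fromℕ n) ≡ x
lookup-∷ʳ-fromℕ []       x = refl
lookup-∷ʳ-fromℕ (y ∷ xs) x = lookup-∷ʳ-fromℕ xs x

lookup-∷ʳ-inject₁ : ∀ (xs : Vec A n) x i → lookup (xs ∷ʳ x) (inject₁ i) ≡ lookup xs i
lookup-∷ʳ-inject₁ (y ∷ xs) x zero    = refl
lookup-∷ʳ-inject₁ (y ∷ xs) x (suc i) = lookup-∷ʳ-inject₁ xs x i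

-- Placing `opposite` on the reversed side lets the induction follow `xs`: the head lands at
-- `fromℕ`, and the entries of the tail at `inject₁` of their opposites.
lookup-reverse-opposite : ∀ (xs : Vec A n) i → lookup (reverse xs) (opposite i) ≡ lookup xs i
lookup-reverse-opposite (x ∷ xs) zero rewrite reverse-∷ x xs = lookup-∷ʳ-fromℕ (reverse xs) x
lookup-reverse-opposite (x ∷ xs) (suc i) rewrite reverse-∷ x xs =
  trans (lookup-∷ʳ-inject₁ (reverse xs) x (opposite i)) (lookup-reverse-opposite xs i)

lookup-reverse : ∀ (xs : Vec A n) i → lookup (reverse xs) i ≡ lookup xs (opposite i)
lookup-reverse xs i = trans
  (cong (lookup (reverse xs)) (sym (opposite-involutive i)))
  (lookup-reverse-opposite xs (opposite i))

reverse-tabulate : ∀ (f : Fin n → A) → reverse (tabulate f) ≡ tabulate (f ∘ opposite)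
reverse-tabulate f = trans (sym (tabulate∘lookup _)) (tabulate-cong λ i →
  trans (lookup-reverse (tabulate f) i) (lookup∘tabulate f (opposite i)))

Pointwise-∷ʳ : ∀ {R : A → B → Set} {xs : Vec A n} {ys : Vec B n} {x y} →
               Pointwise R xs ys → R x y → Pointwise R (xs ∷ʳ x) (ys ∷ʳ y)
Pointwise-∷ʳ []       q = q ∷ []
Pointwise-∷ʳ (r ∷ rs) q = r ∷ Pointwise-∷ʳ rs q

Pointwise-reverse : ∀ {R : A → B → Set} {xs : Vec A n} {ys : Vec B n} →
                    Pointwise R xs ys → Pointwise R (reverse xs) (reverse ys)
Pointwise-reverse [] = []
Pointwise-reverse {R = R} (_∷_ {x = x} {y} {xs} {ys} r rs) =
  subst₂ (Pointwise R) (sym (reverse-∷ x xs)) (sym (reverse-∷ y ys))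
    (Pointwise-∷ʳ (Pointwise-reverse rs) r)

-- The old last entry `x` is kept visible in the type, since only the link from it to `y` is new.
Linked-∷ʳ : ∀ {R : A → A → Set} (xs : Vec A n) {x y} →
            Linked R (xs ∷ʳ x) → R x y → Linked R ((xs ∷ʳ x) ∷ʳ y)
Linked-∷ʳ []            l       r = r ∷ [-]
Linked-∷ʳ (_ ∷ [])      (q ∷ l) r = q ∷ Linked-∷ʳ [] l r
Linked-∷ʳ (_ ∷ z ∷ zs)  (q ∷ l) r = q ∷ Linked-∷ʳ (z ∷ zs) l r

Linked-reverse : ∀ {R : A → A → Set} {xs : Vec A n} →
                 Linked R xs → Linked (flip R) (reverse xs)
Linked-reverse []  = []
Linked-reverse [-] = [-]
Linked-reverse {R = R} (_∷_ {x = x} {xs = y ∷ ys} r l) =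
  subst (Linked (flip R)) (sym (reverse-∷ x (y ∷ ys)))
    (subst (λ zs → Linked (flip R) (zs ∷ʳ x)) (sym (reverse-∷ y ys))
      (Linked-∷ʳ (reverse ys)
        (subst (Linked (flip R)) (reverse-∷ y ys) (Linked-reverse l)) r))

-- Parity

odd⇒even-suc : ∀ n → Odd n → Even (suc n)
odd⇒even-suc zero          o = contradiction (∣._∣0 2) o
odd⇒even-suc (suc zero)    o = ∣-refl
odd⇒even-suc (suc (suc n)) o =
  ∣.∣m∣n⇒∣m+n ∣-refl (odd⇒even-suc n (o ∘ ∣.∣m∣n⇒∣m+n ∣-refl))

-- Both successors are even, and their sum exceeds `m ℕ.+ n` by 2.
odd+odd⇒even : ∀ m n → Odd m → Odd n → Even (m ℕ.+ n)
odd+odd⇒even m n om on = ∣.∣m+n∣m⇒∣n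
  (subst Even (cong suc (ℕ.+-suc m n))
    (∣.∣m∣n⇒∣m+n (odd⇒even-suc m om) (odd⇒even-suc n on)))
  ∣-refl

even-∸⇒odd : ∀ {p n} → Odd p → n ≤ p → Even n → Odd (p ∸ n)
even-∸⇒odd op n≤p en e = op (subst Even (ℕ.m∸n+n≡m n≤p) (∣.∣m∣n⇒∣m+n e en))

odd-∸⇒even : ∀ {p n} → Odd p → n ≤ p → Odd n → Even (p ∸ n)
-- `Odd` is a negation, so evenness is first obtained doubly negated and then extracted by
-- decidability of divisibility by 2.
odd-∸⇒even {p} {n} op n≤p on = decidable-stable (2 ∣? (p ∸ n)) λ o →
  op (subst Even (ℕ.m∸n+n≡m n≤p) (odd+odd⇒even (p ∸ n) n o on))

even⇒odd-suc : ∀ {n} → Even n → Odd (suc n)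
even⇒odd-suc {n} e e′ with () ← ∣1⇒≡1 (∣.∣m+n∣m⇒∣n (subst Even (ℕ.+-comm 1 n) e′) e)

prime≢2⇒odd : ∀ {p} → Prime p → ¬ p ≡ 2 → Odd p
prime≢2⇒odd pr p≢2 e with prime⇒irreducible pr e
... | inj₂ 2≡p = p≢2 (sym 2≡p)

-- Congruences

-- The endpoints are explicit because a congruence unfolds to divisibility of `a ℤ.- b`, which does
-- not determine `a` and `b`.
mod-by : ∀ {n} a b {c} → a ℤ.- b ≡ c → (+ n) ℤ∣.∣ c → a ≡ b [mod n ]
mod-by {n} _ _ eq = subst ((+ n) ℤ∣.∣_) (sym eq)

mod-refl : ∀ n a → a ≡ a [mod n ]
mod-refl n a = divides 0ℤ (ℤ.+-inverseʳ a)

mod-+ : ∀ {n} a b c d → a ≡ b [mod n ] → c ≡ d [mod n ] → (a ℤ.+ c) ≡ (b ℤ.+ d) [mod n ]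
mod-+ a b c d h k = mod-by (a ℤ.+ c) (b ℤ.+ d) (eq a b c d) (ℤ∣.∣m∣n⇒∣m+n h k)
  where
  eq : ∀ a b c d → (a ℤ.+ c) ℤ.- (b ℤ.+ d) ≡ (a ℤ.- b) ℤ.+ (c ℤ.- d)
  eq = solve-∀

mod-* : ∀ {n} a b c d → a ≡ b [mod n ] → c ≡ d [mod n ] → (a ℤ.* c) ≡ (b ℤ.* d) [mod n ]
mod-* a b c d h k =
  mod-by (a ℤ.* c) (b ℤ.* d) (eq a b c d) (ℤ∣.∣m∣n⇒∣m+n (ℤ∣.∣n⇒∣m*n c h) (ℤ∣.∣n⇒∣m*n b k))
  where
  eq : ∀ a b c d → (a ℤ.* c) ℤ.- (b ℤ.* d) ≡ c ℤ.* (a ℤ.- b) ℤ.+ b ℤ.* (c ℤ.- d)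
  eq = solve-∀

mod-^ : ∀ {n} a b k → a ≡ b [mod n ] → (a ℤ.^ k) ≡ (b ℤ.^ k) [mod n ]
mod-^ {n} a b zero    h = mod-refl n 1ℤ
mod-^ {n} a b (suc k) h = mod-* a b (a ℤ.^ k) (b ℤ.^ k) h (mod-^ a b k h)

mod-sum : ∀ {n} c (f g : A → ℤ) {xs} → ListAll.All (λ x → f x ≡ (c ℤ.* g x) [mod n ]) xs →
          sumℤ (List.map f xs) ≡ (c ℤ.* sumℤ (List.map g xs)) [mod n ]
mod-sum {n = n} c f g ListAll.[] =
  subst (λ z → 0ℤ ≡ z [mod n ]) (sym (ℤ.*-zeroʳ c)) (mod-refl n 0ℤ)
mod-sum {n = n} c f g {x ∷ xs} (h ListAll.∷ hs) =
  subst (λ z → sumℤ (List.map f (x ∷ xs)) ≡ z [mod n ])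
    (sym (ℤ.*-distribˡ-+ c (g x) (sumℤ (List.map g xs))))
    (mod-+ (f x) (c ℤ.* g x) (sumℤ (List.map f xs)) (c ℤ.* sumℤ (List.map g xs))
      h (mod-sum c f g hs))

neg-^ : ∀ b k → (ℤ.- b) ℤ.^ k ≡ (-1ℤ ℤ.^ k) ℤ.* (b ℤ.^ k)
neg-^ b zero    = refl
neg-^ b (suc k) = trans (cong ((ℤ.- b) ℤ.*_) (neg-^ b k)) (eq b (-1ℤ ℤ.^ k) (b ℤ.^ k))
  where
  eq : ∀ b x y → (ℤ.- b) ℤ.* (x ℤ.* y) ≡ (-1ℤ ℤ.* x) ℤ.* (b ℤ.* y)
  eq = solve-∀

InRange : ℕ → ℕ → Set
InRange p n = 0 < n × n < p

-- With `a` and `b` the inverses of `p ∸ n` and `n`, the sum `a + b` is a combination of `n b - 1`,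
-- `(p - n) a - 1` and `p`, each divisible by `p`. Only the defining property of inverses enters,
-- not the Bézout coefficients themselves.
inverse-∸ : ∀ {p n} → Prime p → InRange p n →
            inverse p (p ∸ n) ≡ (ℤ.- inverse p n) [mod p ]
inverse-∸ {p} {n} pr (0<n , n<p) =
  mod-by a (ℤ.- b) (eq a b (+ n) (+ p))
    (ℤ∣.∣m∣n⇒∣m+n (ℤ∣.∣m∣n⇒∣m+n (ℤ∣.∣n⇒∣m*n (ℤ.- a) n⁻¹) (ℤ∣.∣n⇒∣m*n (ℤ.- b) [p-n]⁻¹))
      (ℤ∣.∣n⇒∣m*n (a ℤ.* b) ℤ∣.∣-refl))
  where
  a = inverse p (p ∸ n)
  b = inverse p n
  n⁻¹ : ((+ n) ℤ.* b) ≡ 1ℤ [mod p ]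
  n⁻¹ = inverse-correct pr {{ℕ.>-nonZero 0<n}} n<p
  [p-n]⁻¹ : ((+ p ℤ.- + n) ℤ.* a) ≡ 1ℤ [mod p ]
  [p-n]⁻¹ = subst (λ z → (z ℤ.* a) ≡ 1ℤ [mod p ])
    -- Truncated subtraction becomes integer subtraction, as `n < p`; the ring identity `eq` needs
    -- the latter.
    (trans (sym (ℤ.⊖-≥ (ℕ.<⇒≤ n<p))) (sym (ℤ.m-n≡m⊖n p n)))
    (inverse-correct pr {{ℕ.>-nonZero (ℕ.m<n⇒0<n∸m n<p)}} (ℕ.∸-monoʳ-< 0<n (ℕ.<⇒≤ n<p)))
  eq : ∀ a b n p → a ℤ.- (ℤ.- b) ≡
       (ℤ.- a) ℤ.* (n ℤ.* b ℤ.- 1ℤ) ℤ.+ (ℤ.- b) ℤ.* ((p ℤ.- n) ℤ.* a ℤ.- 1ℤ) ℤ.+ (a ℤ.* b) ℤ.* p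
  eq = solve-∀

-- Reflection of admissible tuples

reflect : ℕ → Vec ℕ d → Vec ℕ d
reflect p ns = reverse (map (p ∸_) ns)

-- The first link already puts a natural number strictly below `p`. Applied to the tail of a chain,
-- this gives positivity of the entry heading it.
0<-bound : ∀ {p} (ns : Vec ℕ d) → Linked _>_ (p ∷ (ns ∷ʳ 0)) → 0 < p
0<-bound []      (p>0 ∷ _) = p>0
0<-bound (_ ∷ _) (p>n ∷ _) = ℕ.m<n⇒0<n p>n

linked⇒inRange : ∀ {p} (ns : Vec ℕ d) → Linked _>_ (p ∷ (ns ∷ʳ 0)) → All (InRange p) ns
linked⇒inRange []       _         = []
-- The recursive call bounds the later entries by `n`; `widen` relaxes that bound to `p`.
linked⇒inRange {p = p} (n ∷ ns) (p>n ∷ l) = (0<-bound ns l , p>n) ∷ widen (linked⇒inRange ns l)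
  where
  widen : ∀ {k} {ms : Vec ℕ k} → All (InRange n) ms → All (InRange p) ms
  widen []                = []
  widen ((0<m , m<n) ∷ h) = (0<m , ℕ.<-trans m<n p>n) ∷ widen h

-- The range hypothesis is what makes truncated subtraction from `p` undo itself; the two reversals
-- cancel because `map` commutes with `reverse`.
reflect-involutive : ∀ {p} {ns : Vec ℕ d} → All (InRange p) ns → reflect p (reflect p ns) ≡ ns
reflect-involutive {p = p} {ns} h = begin
  reverse (map (p ∸_) (reverse (map (p ∸_) ns)))  ≡⟨ cong reverse (map-reverse (p ∸_) (map (p ∸_) ns)) ⟩
  reverse (reverse (map (p ∸_) (map (p ∸_) ns)))  ≡⟨ reverse-involutive (map (p ∸_) (map (p ∸_) ns)) ⟩
  map (p ∸_) (map (p ∸_) ns)                      ≡⟨ ∸-∸ h ⟩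
  ns                                              ∎
  where
  open ≡-Reasoning
  ∸-∸ : ∀ {k} {ms : Vec ℕ k} → All (InRange p) ms → map (p ∸_) (map (p ∸_) ms) ≡ ms
  ∸-∸ []              = refl
  ∸-∸ ((_ , m<p) ∷ h) = cong₂ _∷_ (ℕ.m∸[m∸n]≡n (ℕ.<⇒≤ m<p)) (∸-∸ h)

-- Subtraction from `p` reverses strict inequalities as long as nothing is truncated. A bound on the
-- head suffices, since the chain decreases.
Linked-∸ : ∀ {p} {xs : Vec ℕ (suc n)} → head xs ≤ p → Linked _>_ xs → Linked _<_ (map (p ∸_) xs)
Linked-∸ x≤p [-] = [-]
Linked-∸ x≤p (_∷_ {xs = _ ∷ _} x>y l) =
  ℕ.∸-monoʳ-< x>y x≤p ∷ Linked-∸ (ℕ.≤-trans (ℕ.<⇒≤ x>y) x≤p) l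

-- The chain is treated as one vector, endpoints included: subtraction from `p` exchanges `p` and 0,
-- and reversal puts them back in place.
linked-reflect : ∀ {p} (ns : Vec ℕ d) → Linked _>_ (p ∷ (ns ∷ʳ 0)) →
                 Linked _>_ (p ∷ (reflect p ns ∷ʳ 0))
linked-reflect {p = p} ns l = subst (Linked _>_) eq (Linked-reverse (Linked-∸ ℕ.≤-refl l))
  where
  open ≡-Reasoning
  eq : reverse (map (p ∸_) (p ∷ (ns ∷ʳ 0))) ≡ p ∷ (reflect p ns ∷ʳ 0)
  eq = begin
    reverse ((p ∸ p) ∷ map (p ∸_) (ns ∷ʳ 0))   ≡⟨ reverse-∷ (p ∸ p) (map (p ∸_) (ns ∷ʳ 0)) ⟩
    reverse (map (p ∸_) (ns ∷ʳ 0)) ∷ʳ (p ∸ p)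
      ≡⟨ cong₂ (λ xs x → reverse xs ∷ʳ x) (map-∷ʳ (p ∸_) 0 ns) (ℕ.n∸n≡0 p) ⟩
    reverse (map (p ∸_) ns ∷ʳ p) ∷ʳ 0          ≡⟨ cong (_∷ʳ 0) (reverse-∷ʳ (map (p ∸_) ns) p) ⟩
    p ∷ (reflect p ns ∷ʳ 0)                    ∎

-- For odd `p`, passing from `n` to `p ∸ n` flips the parity, and negating the sign exchanges the
-- two clauses of `ParityMatches`.
parity-∸ : ∀ {p} → Odd p → {s : Vec ℤ d} {ns : Vec ℕ d} → All (InRange p) ns →
           Pointwise ParityMatches s ns → Pointwise ParityMatches (map ℤ.-_ s) (map (p ∸_) ns)
parity-∸ op []             []                  = []
parity-∸ op ((_ , n<p) ∷ h) ((even , odd) ∷ pm) =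
  ( (λ -s>0 → odd-∸⇒even op (ℕ.<⇒≤ n<p) (odd (ℤ.neg-cancel-< -s>0)))
  , (λ -s<0 → even-∸⇒odd op (ℕ.<⇒≤ n<p) (even (ℤ.neg-cancel-< -s<0))))
  ∷ parity-∸ op h pm

admissible-reflect : ∀ {p} → Odd p → (s : Vec ℤ d) (ns : Vec ℕ d) → Admissible p s ns →
                     Admissible p (reverse (map ℤ.-_ s)) (reflect p ns)
admissible-reflect op s ns (l , pm) =
  linked-reflect ns l , Pointwise-reverse (parity-∸ op (linked⇒inRange ns l) pm)

-- Enumeration of admissible tuples

∈-tuples : ∀ {p} {ns : Vec ℕ d} → All (InRange p) ns → ns ∈ tuples (List.upTo p) d
∈-tuples []              = here refl
∈-tuples ((_ , n<p) ∷ h) = ∈-cartesianProductWith⁺ _∷_ (∈-upTo⁺ n<p) (∈-tuples h)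

tuples-unique : ∀ {xs : List A} → Unique xs → ∀ d → Unique (tuples xs d)
tuples-unique u zero    = ListAll.[] ∷ []
tuples-unique u (suc d) = Unique.cartesianProductWith⁺ _∷_ ∷-injective u (tuples-unique u d)

admissibleTuples-unique : ∀ p (s : Vec ℤ d) → Unique (admissibleTuples p s)
admissibleTuples-unique p s = Unique.filter⁺ (admissible? p s) (tuples-unique (Unique.upTo⁺ p) _)

∈-admissibleTuples⁺ : ∀ p (s : Vec ℤ d) {ns} → Admissible p s ns → ns ∈ admissibleTuples p s
∈-admissibleTuples⁺ p s {ns} adm =
  ∈-filter⁺ (admissible? p s) (∈-tuples (linked⇒inRange ns (proj₁ adm))) adm

∈-admissibleTuples⁻ : ∀ p (s : Vec ℤ d) {ns} → ns ∈ admissibleTuples p s → Admissible p s ns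
∈-admissibleTuples⁻ p s ns∈ = proj₂ (∈-filter⁻ (admissible? p s) {xs = tuples (List.upTo p) _} ns∈)

map-neg-involutive : ∀ (s : Vec ℤ d) → map ℤ.-_ (map ℤ.-_ s) ≡ s
map-neg-involutive s =
  trans (sym (map-∘ ℤ.-_ ℤ.-_ s)) (trans (map-cong ℤ.neg-involutive s) (map-id s))

-- Neither list has repetitions, so it is enough that they have the same members. Reflection is an
-- involution on admissible tuples, so `admissible-reflect` serves both inclusions.
reflect-↭ : ∀ {p} → Odd p → (s : Vec ℤ d) →
            admissibleTuples p (reverse s) ↭ List.map (reflect p) (admissibleTuples p (map ℤ.-_ s))
reflect-↭ {p = p} op s = ∼bag⇒↭ (unique∧set⇒bag
  (admissibleTuples-unique p (reverse s)) reflected-unique (mk⇔ to from))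
  where
  -s = map ℤ.-_ s

  -- reflect p is injective only on tuples in range, so uniqueness is pulled
  -- back along a second application of reflect p.
  reflected-unique : Unique (List.map (reflect p) (admissibleTuples p -s))
  reflected-unique = Unique.map⁻ {f = reflect p} (subst Unique
    (sym (trans (sym (List.map-∘ {g = reflect p} {f = reflect p} (admissibleTuples p -s)))
      (List.map-id-local {f = reflect p ∘ reflect p}
        (ListAll.map (λ {ns} → reflect-involutive ∘ linked⇒inRange ns ∘ proj₁)
          (all-filter (admissible? p -s) (tuples (List.upTo p) _))))))
    (admissibleTuples-unique p -s))

  to : ∀ {ns} → ns ∈ admissibleTuples p (reverse s) →
       ns ∈ List.map (reflect p) (admissibleTuples p -s)
  to {ns} ns∈ = subst (_∈ List.map (reflect p) (admissibleTuples p -s))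
    (reflect-involutive (linked⇒inRange ns (proj₁ adm)))
    (∈-map⁺ (reflect p) (∈-admissibleTuples⁺ p -s
      (subst (λ u → Admissible p u (reflect p ns)) eq (admissible-reflect op (reverse s) ns adm))))
    where
    adm = ∈-admissibleTuples⁻ p (reverse s) ns∈
    eq : reverse (map ℤ.-_ (reverse s)) ≡ -s
    eq = trans (cong reverse (map-reverse ℤ.-_ s)) (reverse-involutive -s)

  from : ∀ {ns} → ns ∈ List.map (reflect p) (admissibleTuples p -s) →
         ns ∈ admissibleTuples p (reverse s)
  from ns∈ with ms , ms∈ , refl ← ∈-map⁻ (reflect p) ns∈ = ∈-admissibleTuples⁺ p (reverse s)
    (subst (λ u → Admissible p (reverse u) (reflect p ms)) (map-neg-involutive s)
      (admissible-reflect op -s ms (∈-admissibleTuples⁻ p -s ms∈)))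

-- Terms of the sum

-- A global copy of the summand inside `M𝒜`, definitionally equal to it, so that single summands can
-- be reasoned about.
term : ∀ {d} → ℕ → Vec ℤ d → Vec ℕ d → ℤ
term p s ns = productℤ (zipWith (λ sⱼ nⱼ → inverse p nⱼ ℤ.^ ∣ sⱼ ∣) s ns)

term-∷ʳ : ∀ p (s : Vec ℤ d) ns x n →
          term p (s ∷ʳ x) (ns ∷ʳ n) ≡ term p (x ∷ s) (n ∷ ns)
term-∷ʳ p []      []       x n = refl
term-∷ʳ p (y ∷ s) (m ∷ ns) x n = trans
  (cong ((inverse p m ℤ.^ ∣ y ∣) ℤ.*_) (term-∷ʳ p s ns x n))
  (eq (inverse p m ℤ.^ ∣ y ∣) (inverse p n ℤ.^ ∣ x ∣) (term p s ns))
  where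
  eq : ∀ a b c → a ℤ.* (b ℤ.* c) ≡ b ℤ.* (a ℤ.* c)
  eq = solve-∀

term-reverse : ∀ p (s : Vec ℤ d) ns → term p (reverse s) (reverse ns) ≡ term p s ns
term-reverse p []      []       = refl
term-reverse p (x ∷ s) (n ∷ ns) = begin
  term p (reverse (x ∷ s)) (reverse (n ∷ ns))
    ≡⟨ cong₂ (term p) (reverse-∷ x s) (reverse-∷ n ns) ⟩
  term p (reverse s ∷ʳ x) (reverse ns ∷ʳ n)
    ≡⟨ term-∷ʳ p (reverse s) (reverse ns) x n ⟩
  term p (x ∷ reverse s) (n ∷ reverse ns)
    ≡⟨ cong ((inverse p n ℤ.^ ∣ x ∣) ℤ.*_) (term-reverse p s ns) ⟩
  term p (x ∷ s) (n ∷ ns) ∎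
  where open ≡-Reasoning

-- Each factor contributes `-1ℤ ℤ.^ ∣ sⱼ ∣`, and these signs multiply to the power given by the
-- weight. Negating `s` on the right leaves the exponents unchanged, as only absolute values enter,
-- and yields the summand of the target sum.
term-∸ : ∀ {p} → Prime p → (s : Vec ℤ d) {ns : Vec ℕ d} → All (InRange p) ns →
         term p s (map (p ∸_) ns) ≡ ((-1ℤ ℤ.^ weight s) ℤ.* term p (map ℤ.-_ s) ns) [mod p ]
term-∸ {p = p} pr []      []                  = mod-refl p 1ℤ
term-∸ {p = p} pr (x ∷ s) (_∷_ {x = n} {xs = ns} r h) =
  subst (λ z → term p (x ∷ s) (map (p ∸_) (n ∷ ns)) ≡ z [mod p ]) eq
    (mod-* (a ℤ.^ k) ((ℤ.- b) ℤ.^ k) (term p s (map (p ∸_) ns)) (c ℤ.* t)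
      (mod-^ a (ℤ.- b) k (inverse-∸ pr r)) (term-∸ pr s h))
  where
  open ≡-Reasoning
  a = inverse p (p ∸ n)
  b = inverse p n
  k = ∣ x ∣
  c = -1ℤ ℤ.^ weight s
  t = term p (map ℤ.-_ s) ns
  interchange : ∀ a b c d → (a ℤ.* b) ℤ.* (c ℤ.* d) ≡ (a ℤ.* c) ℤ.* (b ℤ.* d)
  interchange = solve-∀
  eq : ((ℤ.- b) ℤ.^ k) ℤ.* (c ℤ.* t) ≡
       (-1ℤ ℤ.^ (k ℕ.+ weight s)) ℤ.* ((b ℤ.^ ∣ ℤ.- x ∣) ℤ.* t)
  eq = begin
    ((ℤ.- b) ℤ.^ k) ℤ.* (c ℤ.* t)                  ≡⟨ cong (ℤ._* (c ℤ.* t)) (neg-^ b k) ⟩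
    ((-1ℤ ℤ.^ k) ℤ.* (b ℤ.^ k)) ℤ.* (c ℤ.* t)      ≡⟨ interchange (-1ℤ ℤ.^ k) (b ℤ.^ k) c t ⟩
    ((-1ℤ ℤ.^ k) ℤ.* c) ℤ.* ((b ℤ.^ k) ℤ.* t)
      ≡⟨ cong₂ (λ u j → u ℤ.* ((b ℤ.^ j) ℤ.* t))
           (sym (ℤ.^-distribˡ-+-* -1ℤ k (weight s))) (sym (ℤ.∣-i∣≡∣i∣ x)) ⟩
    (-1ℤ ℤ.^ (k ℕ.+ weight s)) ℤ.* ((b ℤ.^ ∣ ℤ.- x ∣) ℤ.* t) ∎

-- The reversal formula for M

sumℤ-↭ : ∀ {xs ys} → xs ↭ ys → sumℤ xs ≡ sumℤ ys
sumℤ-↭ xs↭ys = ↭ₛ.foldr-commMonoid (setoid ℤ) ℤ.+-0-isCommutativeMonoid (↭⇒↭ₛ xs↭ys)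

-1#-^ : ∀ k p .(pr : Prime p) → ((- 1#) ^ k) p pr ≡ -1ℤ ℤ.^ k
-1#-^ zero    p pr = refl
-1#-^ (suc k) p pr = cong (-1ℤ ℤ.*_) (-1#-^ k p pr)

-- At one odd prime: reindex the left sum along reflection, then compare it with the right sum term
-- by term.
M𝒜-reverse-mod : ∀ {p} (pr : Prime p) → Odd p → (s : Vec ℤ d) →
                 M𝒜 (reverse s) p pr ≡ ((-1ℤ ℤ.^ weight s) ℤ.* M𝒜 (map ℤ.-_ s) p pr) [mod p ]
M𝒜-reverse-mod {p = p} pr op s =
  subst (λ z → z ≡ (c ℤ.* M𝒜 -s p pr) [mod p ]) (sym sum-reflected)
    (mod-sum c (term p (reverse s) ∘ reflect p) (term p -s)
      (ListAll.map (λ {ns} → congruent ns) (all-filter (admissible? p -s) (tuples (List.upTo p) _))))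
  where
  open ≡-Reasoning
  -s = map ℤ.-_ s
  c = -1ℤ ℤ.^ weight s
  sum-reflected : M𝒜 (reverse s) p pr ≡
    sumℤ (List.map (term p (reverse s) ∘ reflect p) (admissibleTuples p -s))
  sum-reflected = begin
    M𝒜 (reverse s) p pr
      ≡⟨ sumℤ-↭ (↭.map⁺ (term p (reverse s)) (reflect-↭ op s)) ⟩
    sumℤ (List.map (term p (reverse s)) (List.map (reflect p) (admissibleTuples p -s)))
      ≡⟨ cong sumℤ (sym (List.map-∘ (admissibleTuples p -s))) ⟩
    sumℤ (List.map (term p (reverse s) ∘ reflect p) (admissibleTuples p -s)) ∎
  congruent : ∀ ns → Admissible p -s ns →
    term p (reverse s) (reflect p ns) ≡ (c ℤ.* term p -s ns) [mod p ]
  congruent ns (l , _) = subst (λ z → z ≡ (c ℤ.* term p -s ns) [mod p ])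
    (sym (term-reverse p s (map (p ∸_) ns))) (term-∸ pr s (linked⇒inRange ns l))

M𝒜-reverse : ∀ (s : Vec ℤ d) → M𝒜 (reverse s) ≈ ((- 1#) ^ weight s) * M𝒜 (map ℤ.-_ s)
-- The exception is the even prime, where `n` and `p ∸ n` have equal parity.
M𝒜-reverse s = [ 2 ] , λ p pr p∉ →
  subst (λ z → M𝒜 (reverse s) p pr ≡ (z ℤ.* M𝒜 (map ℤ.-_ s) p pr) [mod p ])
    (sym (-1#-^ (weight s) p pr))
    -- Families receive primality as an irrelevant argument; decidability recovers a usable proof.
    (M𝒜-reverse-mod (recompute (prime? p) pr)
      (prime≢2⇒odd (recompute (prime? p) pr) (p∉ ∘ here)) s)

-- Sign patterns

∣-1^∣≡1 : ∀ k → ∣ -1ℤ ℤ.^ k ∣ ≡ 1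
∣-1^∣≡1 zero    = refl
∣-1^∣≡1 (suc k) = trans (ℤ.abs-* -1ℤ (-1ℤ ℤ.^ k)) (trans (ℕ.*-identityˡ _) (∣-1^∣≡1 k))

-1^even : ∀ k → Even k → -1ℤ ℤ.^ k ≡ 1ℤ
-1^even zero          _ = refl
-1^even (suc zero)    e with () ← ∣1⇒≡1 e
-1^even (suc (suc k)) e = cong (λ z → -1ℤ ℤ.* (-1ℤ ℤ.* z)) (-1^even k (∣.∣m+n∣m⇒∣n e ∣-refl))

-- The induction moves one unit at a time from `a` to `b`, preserving the sum, until `b` alone is
-- odd.
-1^-opposite : ∀ a b → Odd (a ℕ.+ b) → ℤ.- (-1ℤ ℤ.^ a) ≡ -1ℤ ℤ.^ b
-1^-opposite zero    b o = neg b o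
  where
  neg : ∀ b → Odd b → ℤ.- 1ℤ ≡ -1ℤ ℤ.^ b
  neg b o = trans (cong ℤ.-_ (sym (-1^even (suc b) (odd⇒even-suc b o))))
    (eq (-1ℤ ℤ.^ b))
    where
    eq : ∀ x → ℤ.- (-1ℤ ℤ.* x) ≡ x
    eq = solve-∀
-1^-opposite (suc a) b o = trans (cong (λ z → ℤ.- (-1ℤ ℤ.* z)) (eq₁ (-1ℤ ℤ.^ a)))
  (trans (cong (λ z → ℤ.- (-1ℤ ℤ.* ℤ.- z)) (-1^-opposite a (suc b) (subst Odd (sym (ℕ.+-suc a b)) o)))
    (eq₂ (-1ℤ ℤ.^ b)))
  where
  eq₁ : ∀ x → x ≡ ℤ.- (ℤ.- x)
  eq₁ = solve-∀
  eq₂ : ∀ x → ℤ.- (-1ℤ ℤ.* ℤ.- (-1ℤ ℤ.* x)) ≡ x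
  eq₂ = solve-∀

-- The common shape of the index vectors of `T𝒜` and `S𝒜`, which are definitionally the cases
-- `T-exponent` and `S-exponent`.
signed : (Fin d → ℕ) → Vec ℕ d → Vec ℤ d
signed e s = tabulate λ i → (-1ℤ ℤ.^ e i) ℤ.* (+ lookup s i)

weight-signed : ∀ (e : Fin d → ℕ) (s : Vec ℕ d) → weight (signed e s) ≡ sum s
weight-signed e s = cong sum (begin
  map ∣_∣ (signed e s)                                        ≡⟨ tabulate-∘ ∣_∣ _ ⟨
  tabulate (λ i → ∣ (-1ℤ ℤ.^ e i) ℤ.* (+ lookup s i) ∣)       ≡⟨ tabulate-cong abs ⟩
  tabulate (lookup s)                                         ≡⟨ tabulate∘lookup s ⟩
  s                                                           ∎)
  where
  open ≡-Reasoning
  abs : ∀ i → ∣ (-1ℤ ℤ.^ e i) ℤ.* (+ lookup s i) ∣ ≡ lookup s i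
  abs i = trans (ℤ.abs-* (-1ℤ ℤ.^ e i) (+ lookup s i))
    (trans (cong (ℕ._* lookup s i) (∣-1^∣≡1 (e i))) (ℕ.*-identityˡ _))

-- The general formula is applied to `signed (e ∘ opposite) s`: its reversal is the index on the
-- left, and the oddness condition makes its negation the index on the right.
M𝒜-signed-reverse : ∀ (e e′ : Fin d → ℕ) (s : Vec ℕ d) →
                    (∀ i → Odd (e (opposite i) ℕ.+ e′ i)) →
                    M𝒜 (signed e (reverse s)) ≈ ((- 1#) ^ sum s) * M𝒜 (signed e′ s)
M𝒜-signed-reverse e e′ s odd =
  subst (λ u → M𝒜 u ≈ ((- 1#) ^ sum s) * M𝒜 (signed e′ s)) reversed
    (subst₂ (λ w u → M𝒜 (reverse s′) ≈ ((- 1#) ^ w) * M𝒜 u)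
      (weight-signed (e ∘ opposite) s) negated (M𝒜-reverse s′))
  where
  s′ = signed (e ∘ opposite) s
  reversed : reverse s′ ≡ signed e (reverse s)
  reversed = trans (reverse-tabulate _) (tabulate-cong λ i → cong₂ (λ j n → (-1ℤ ℤ.^ e j) ℤ.* (+ n))
    (opposite-involutive i) (sym (lookup-reverse s i)))
  negated : map ℤ.-_ s′ ≡ signed e′ s
  negated = trans (sym (tabulate-∘ ℤ.-_ _)) (tabulate-cong λ i → trans
    (ℤ.neg-distribˡ-* (-1ℤ ℤ.^ e (opposite i)) (+ lookup s i))
    (cong (ℤ._* (+ lookup s i)) (-1^-opposite (e (opposite i)) (e′ i) (odd i))))

t𝒜-reverse : ∀ (s : Vec ℕ d) → t𝒜 (reverse s) ≈ ((- 1#) ^ sum s) * ζ⁽²⁾𝒜 s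
t𝒜-reverse s =
  subst (λ u → M𝒜 u ≈ ((- 1#) ^ sum s) * ζ⁽²⁾𝒜 s) (sym (map-reverse neg s))
    (subst₂ (λ w u → M𝒜 (reverse (map neg s)) ≈ ((- 1#) ^ w) * M𝒜 u)
      weight-neg negated (M𝒜-reverse (map neg s)))
  where
  neg : ℕ → ℤ
  neg n = ℤ.- (+ n)
  weight-neg : weight (map neg s) ≡ sum s
  weight-neg = cong sum (trans (sym (map-∘ ∣_∣ neg s))
    (trans (map-cong (λ n → ℤ.∣-i∣≡∣i∣ (+ n)) s) (map-id s)))
  negated : map ℤ.-_ (map neg s) ≡ map +_ s
  negated = trans (sym (map-∘ ℤ.-_ neg s)) (map-cong (λ n → ℤ.neg-involutive (+ n)) s)

-- Sign exponents of T and S under reversal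

T-exponent S-exponent : Fin d → ℕ
T-exponent {d} i = d ∸ toℕ i
S-exponent {d} i = d ∸ suc (toℕ i)

T-exponent-opposite : ∀ (i : Fin d) → T-exponent (opposite i) ≡ suc (toℕ i)
T-exponent-opposite {d} i = trans (cong (d ∸_) (opposite-prop i)) (ℕ.m∸[m∸n]≡n (toℕ<n i))

-- `S-exponent i` is the position of `opposite i`, so this is the involutivity of `opposite`.
S-exponent-opposite : ∀ (i : Fin d) → S-exponent (opposite i) ≡ toℕ i
S-exponent-opposite i =
  trans (sym (opposite-prop (opposite i))) (cong toℕ (opposite-involutive i))

-- The exponent sums are `d` for the two mixed pairs, `d + 1` for T with T and `d - 1` for S with S.
-- Hence odd `d` exchanges T and S, while even `d` preserves each.
T-S-sum : ∀ (i : Fin d) → T-exponent (opposite i) ℕ.+ S-exponent i ≡ d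
T-S-sum {d} i = trans (cong (ℕ._+ (d ∸ suc (toℕ i))) (T-exponent-opposite i))
  (ℕ.m+[n∸m]≡n (toℕ<n i))

S-T-sum : ∀ (i : Fin d) → S-exponent (opposite i) ℕ.+ T-exponent i ≡ d
S-T-sum {d} i = trans (cong (ℕ._+ (d ∸ toℕ i)) (S-exponent-opposite i))
  (ℕ.m+[n∸m]≡n (ℕ.<⇒≤ (toℕ<n i)))

T-T-sum : ∀ (i : Fin d) → T-exponent (opposite i) ℕ.+ T-exponent i ≡ suc d
T-T-sum {d} i = trans (cong (ℕ._+ (d ∸ toℕ i)) (T-exponent-opposite i))
  (cong suc (ℕ.m+[n∸m]≡n (ℕ.<⇒≤ (toℕ<n i))))

S-S-sum : ∀ (i : Fin d) → suc (S-exponent (opposite i) ℕ.+ S-exponent i) ≡ d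
S-S-sum {d} i = trans (cong (λ z → suc (z ℕ.+ (d ∸ suc (toℕ i)))) (S-exponent-opposite i))
  (ℕ.m+[n∸m]≡n (toℕ<n i))

proposition2p6 : (∀ (d : ℕ) .{{_ : ℕ.NonZero d}} (s : Vec ℤ d) → All ℤ.NonZero s →
    M𝒜 (reverse s) ≈ ((- 1#) ^ weight s) * M𝒜 (map ℤ.-_ s))
    × (∀ (d : ℕ) .{{_ : ℕ.NonZero d}} (s : Vec ℕ d) → All ℕ.NonZero s →
    (t𝒜 (reverse s) ≈ ((- 1#) ^ sum s) * ζ⁽²⁾𝒜 s)
    × (Even d →
    (T𝒜 (reverse s) ≈ ((- 1#) ^ sum s) * T𝒜 s)
    × (S𝒜 (reverse s) ≈ ((- 1#) ^ sum s) * S𝒜 s))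
    × (Odd d →
    (T𝒜 (reverse s) ≈ ((- 1#) ^ sum s) * S𝒜 s)
    × (S𝒜 (reverse s) ≈ ((- 1#) ^ sum s) * T𝒜 s)))
proposition2p6 = (λ _ s _ → M𝒜-reverse s) , λ _ s _ →
    t𝒜-reverse s
  , (λ even →
      M𝒜-signed-reverse T-exponent T-exponent s
        (λ i → subst Odd (sym (T-T-sum i)) (even⇒odd-suc even))
    , M𝒜-signed-reverse S-exponent S-exponent s
        -- Were the exponent sum even, its successor `d` would be odd.
        (λ i e → even⇒odd-suc e (subst Even (sym (S-S-sum i)) even)))
  , (λ odd →
      M𝒜-signed-reverse T-exponent S-exponent s (λ i → subst Odd (sym (T-S-sum i)) odd)
    , M𝒜-signed-reverse S-exponent T-exponent s (λ i → subst Odd (sym (S-T-sum i)) odd))
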